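{- For every integer $n\ge 15$, every integer in the interval $\left[-\binom{\lfloor(n-15)/3\rfloor}{2},\ \binom{\lfloor(n-15)/3\rfloor}{2}\right]$ is an eigenvalue of $\mathrm{Cay}(S_n,T_n)$.
   Context: $S_n$ is the symmetric group on $\{1,\dots,n\}$ and $T_n\subseteq S_n$ is the set of all transpositions. The transposition graph $\mathrm{Cay}(S_n,T_n)$ is the Cayley graph with vertex set $S_n$ in which $f,g\in S_n$ are adjacent iff $fg^{ -1}\in T_n$. Its eigenvalues are the eigenvalues of its adjacency matrix. (Here $\binom{m}{2}=m(m-1)/2$, so it is $0$ for $m\in\{0,1\}$.) -}

module Defs where

open import Data.Nat as ℕ using (ℕ; _<ᵇ_)
open import Data.Fin using (Fin; toℕ; _≟_)
open import Data.Fin.Properties using ()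
open import Data.Vec using (Vec; lookup; map)
open import Data.List using (List; foldr; allFin)
open import Data.Integer using (ℤ; 0ℤ; _+_; _*_)
open import Data.Bool using (if_then_else_)
open import Data.Product using (∃; Σ; _×_)
open import Relation.Nullary using (¬_; does)
open import Relation.Binary.PropositionalEquality using (_≡_)

-- A permutation f of {1..n} (here Fin n) is represented by its table of
-- values: σ : Vec (Fin n) n with lookup σ k = f(k); it is a permutation iff
-- it is surjective (equivalently bijective, Fin n being finite).
IsPerm : {n : ℕ} → Vec (Fin n) n → Set
IsPerm {n} σ = (i : Fin n) → ∃ λ k → lookup σ k ≡ i

transp : {n : ℕ} → Fin n → Fin n → Fin n → Fin n
transp i j k = if does (k ≟ i) then j else (if does (k ≟ j) then i else k)

compTransp : {n : ℕ} → Fin n → Fin n → Vec (Fin n) n → Vec (Fin n) n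
compTransp i j σ = map (transp i j) σ

sumℤ : List ℤ → ℤ
sumℤ = foldr _+_ 0ℤ

sumPairs : (n : ℕ) → (Fin n → Fin n → ℤ) → ℤ
sumPairs n F = sumℤ (Data.List.map (λ j → sumℤ (Data.List.map
  (λ i → if toℕ i <ᵇ toℕ j then F i j else 0ℤ) (allFin n))) (allFin n))

-- (A v)(f) for the adjacency matrix A of Cay(S_n, T_n):
-- g ~ f iff f g⁻¹ = t ∈ T_n iff g = t ∘ f, so (A v)(f) = Σ_{i<j} v((i j) ∘ f).
adjApply : (n : ℕ) → (Vec (Fin n) n → ℤ) → Vec (Fin n) n → ℤ
adjApply n v σ = sumPairs n (λ i j → v (compTransp i j σ))

-- λ is an eigenvalue of Cay(S_n,T_n): there is a nonzero vector v ∈ ℤ^{S_n}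
-- with A v = λ v.  (Only the values of v on permutations matter.)
IsTranspositionGraphEigenvalue : (n : ℕ) → ℤ → Set
IsTranspositionGraphEigenvalue n λ′ =
  Σ (Vec (Fin n) n → ℤ) λ v →
    (∃ λ σ → IsPerm σ × ¬ (v σ ≡ 0ℤ)) ×
    ((σ : Vec (Fin n) n) → IsPerm σ → adjApply n v σ ≡ λ′ * v σ)

{-# OPTIONS --safe #-}

-- For a partition with column lengths c₁ ≥ c₂ ≥ …, consider the function on words that cuts a word
-- into blocks of lengths c₁, c₂, … and multiplies the signs of the blocks as permutations of
-- {0, …, cᵢ - 1} (0 if one of them is no permutation).  Exchanging two letters of one block changes
-- the sign.  For a fixed letter of a later block, the sum over its exchanges with all letters of the
-- i-th block returns the function itself, by Cramer's rule: the later block vanishes on letters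
-- ≥ cᵢ.  So the sum over all exchanges multiplies the function by the content of the partition, and
-- w ∘ σ⁻¹ carries it to an eigenvector on the symmetric group.
--
-- With T(a) = 1 + … + a, a partition with Frobenius coordinates (A | B) has content ΣT(A) - ΣT(B),
-- where A and B may be any sets of the same size.  Writing k = T(b) - s with 0 ≤ s < b, the
-- coordinates ({b, s - 1} | {s, 0}), or ({b} | {0}) if s = 0, have content k and at most 3b - 1
-- cells; adding a set X to both A and B keeps the content and fills up the remaining cells.
-- Negative k are obtained by conjugation.
module Submission where

open import Defs
open import Data.Nat using (ℕ; _≥_; _∸_; _/_)
open import Data.Nat.Combinatorics using (_C_)
open import Data.Integer using (ℤ; +_; -_; _≤_)

open import Data.Nat as ℕ using (zero; suc; pred; z≤n; s≤s; z<s; s<s; _<ᵇ_)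
import Data.Nat.Properties as ℕ
open import Data.Nat.Combinatorics using (nC1≡n; nCk+nC[k+1]≡[n+1]C[k+1])
open import Data.Nat.DivMod using (m/n*n≤m)
open import Data.Nat.ListAction using (sum)
open import Data.Nat.ListAction.Properties using (sum-↭)
open import Data.Nat.Tactic.RingSolver using () renaming (solve-∀ to solveℕ-∀)
open import Data.Integer as ℤ using (0ℤ; 1ℤ; -[1+_])
import Data.Integer.Properties as ℤ
open import Data.Integer.Tactic.RingSolver using (solve-∀)
open import Algebra.Properties.CommutativeSemigroup ℤ.+-commutativeSemigroup using (interchange)
open import Data.Bool using (if_then_else_; true; false)
open import Data.Fin as Fin using (Fin; zero; suc; toℕ)
open import Data.Fin.Properties as Fin using (any?; all?; pigeonhole; toℕ<n; ¬∀⟶∃¬; toℕ-injective)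
open import Data.List as List
  using (List; []; _∷_; _++_; length; take; drop; tabulate; map; lookup; replicate)
open import Data.List.Properties
  using (take++drop≡id; length-++; length-take; length-drop; length-map; length-replicate;
         length-tabulate; tabulate-cong; tabulate-lookup; map-tabulate)
open import Data.List.Relation.Binary.Permutation.Propositional
  using (_↭_; prep; swap; ↭-refl; ↭-trans; ↭-sym)
open import Data.List.Relation.Binary.Permutation.Propositional.Properties
  using (map⁺; ↭-length; All-resp-↭)
open import Data.List.Relation.Unary.All as All using (All; []; _∷_)
open import Data.List.Relation.Unary.AllPairs using ([]; _∷_)
open import Data.List.Relation.Unary.Any as Any using (Any; here; there)
open import Data.List.Relation.Unary.Any.Properties using (++⁻)
open import Data.List.Relation.Unary.Unique.Propositional using (Unique)
open import Data.Product using (_×_; _,_; ∃-syntax; ∃₂; proj₁; proj₂)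
open import Data.Sum using (_⊎_; inj₁; inj₂)
open import Data.Unit using (⊤; tt)
open import Data.Vec as Vec using (Vec; []; _∷_)
open import Data.Vec.Properties using (lookup-allFin)
open import Function using (_∘_; id)
open import Function.Bundles using (mk⇔)
open import Relation.Binary.Definitions using (tri<; tri≈; tri>)
open import Relation.Binary.PropositionalEquality
open import Relation.Nullary using (Dec; does; yes; no; contradiction)
open import Relation.Nullary.Decidable using (_⊎-dec_; does-⇔; dec-true; dec-false)

-- Frobenius coordinates of prescribed size and content

module _ where

  open import Data.Nat using (_+_; _*_; _<_)

  -- `m C 2` by recursion on `m`, so that Pascal's rule holds by computation.
  choose₂ : ℕ → ℕ
  choose₂ zero = zero
  choose₂ (suc m) = m + choose₂ m

  triangle : ℕ → ℕ
  triangle n = choose₂ (suc n)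

  -- `A` holds the arms and `B` the legs, in any order; the diagonal adds `length A` cells. The
  -- content equation is additive to avoid truncated subtraction.
  Coordinates : ℕ → ℕ → Set
  Coordinates n k = ∃₂ λ A B → Unique A × Unique B × length A ≡ length B ×
    sum A + sum B + length A ≡ n × sum (map triangle A) ≡ k + sum (map triangle B)

  parity : ∀ n → ∃[ m ] (n ≡ 2 * m ⊎ n ≡ suc (2 * m))
  parity zero = 0 , inj₁ refl
  parity (suc n) with parity n
  ... | m , inj₁ refl = m , inj₂ refl
  ... | m , inj₂ refl = suc m , inj₁ (sym (ℕ.*-suc 2 m))

  -- Self-conjugate partitions have content 0: a single symmetric hook for odd size, and one more
  -- diagonal cell for even size.
  coordinates-zero : ∀ n → 3 ℕ.≤ n → Coordinates n 0
  coordinates-zero _ (s≤s (s≤s (s≤s (z≤n {n})))) with parity n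
  ... | m , inj₁ refl = A , A , [] ∷ [] , [] ∷ [] , refl , lemma m , refl
    where
    A = suc m ∷ []
    lemma : ∀ m → suc m + 0 + (suc m + 0) + 1 ≡ 3 + 2 * m
    lemma = solveℕ-∀
  ... | m , inj₂ refl = A , A , uniq , uniq , refl , lemma m , refl
    where
    A = suc m ∷ 0 ∷ []
    uniq : Unique A
    uniq = ((λ ()) ∷ []) ∷ [] ∷ []
    lemma : ∀ m → suc m + 0 + (suc m + 0) + 2 ≡ 3 + suc (2 * m)
    lemma = solveℕ-∀

  triangularCeiling : ∀ k → ∃₂ λ b s → s < b × suc k + s ≡ triangle b
  triangularCeiling zero = 1 , 0 , z<s , refl
  triangularCeiling (suc k) with triangularCeiling k
  ... | b , suc s , s<b , eq = b , s , ℕ.<⇒≤ s<b , trans (sym (ℕ.+-suc (suc k) s)) eq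
  -- `suc k` is the triangular number of `b`; the next one is larger by `b + 1`, which leaves a
  -- deficit of `b`.
  ... | b , zero , _ , eq = suc b , b , ℕ.n<1+n b ,
    cong suc (trans (ℕ.+-comm (suc k) b) (cong (_+_ b) (trans (sym (ℕ.+-identityʳ (suc k))) eq)))

  module _ {k m : ℕ} (large : 2 * suc k < m) where

    private
      candidate : Fin (suc k) → ℕ
      candidate i = suc (toℕ i)

      candidate-+ : ∀ i j → candidate i + candidate j < m
      candidate-+ i j =
        ℕ.≤-<-trans (ℕ.+-mono-≤ (toℕ<n i) (ℕ.≤-trans (toℕ<n j) (ℕ.m≤m+n (suc k) 0))) large

      candidate-<m : ∀ i → candidate i < m
      candidate-<m i = ℕ.≤-<-trans (ℕ.m≤m+n _ _) (candidate-+ i i)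

      candidate-<∸ : ∀ i j → candidate i < m ∸ candidate j
      candidate-<∸ i j = ℕ.m+n≤o⇒m≤o∸n (suc (candidate i)) (candidate-+ i j)

      Hit : Fin (suc k) → ℕ → Set
      Hit i z = z ≡ candidate i ⊎ z ≡ m ∸ candidate i

      hit? : ∀ i z → Dec (Hit i z)
      hit? i z = z ℕ.≟ candidate i ⊎-dec z ℕ.≟ m ∸ candidate i

      -- Any two candidates add up to less than `m`, so every candidate is smaller than every
      -- complement; candidates differ from each other, and so do complements.
      hit-unique : ∀ i j {z} → Hit i z → Hit j z → i ≡ j
      hit-unique i j (inj₁ p) (inj₁ q) = toℕ-injective (ℕ.suc-injective (trans (sym p) q))
      hit-unique i j (inj₁ p) (inj₂ q) = contradiction (trans (sym p) q) (ℕ.<⇒≢ (candidate-<∸ i j))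
      hit-unique i j (inj₂ p) (inj₁ q) = contradiction (trans (sym q) p) (ℕ.<⇒≢ (candidate-<∸ j i))
      hit-unique i j (inj₂ p) (inj₂ q) = toℕ-injective (ℕ.suc-injective
        (ℕ.∸-cancelˡ-≡ (ℕ.<⇒≤ (candidate-<m i)) (ℕ.<⇒≤ (candidate-<m j)) (trans (sym p) q)))

    -- The k + 1 pairs {x, m ∸ x} with 1 ≤ x ≤ k + 1 are disjoint, so one contains no z j.
    pairAvoiding : (z : Fin k → ℕ) →
      ∃₂ λ x y → 0 < x × x < y × x + y ≡ m × ∀ j → z j ≢ x × z j ≢ y
    pairAvoiding z with all? (λ i → any? (λ j → hit? i (z j)))
    ... | no ¬all with i , ¬hit ← ¬∀⟶∃¬ (suc k) _ (λ i → any? (λ j → hit? i (z j))) ¬all =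
      candidate i , m ∸ candidate i , z<s , candidate-<∸ i i , ℕ.m+[n∸m]≡n (ℕ.<⇒≤ (candidate-<m i)) ,
      λ j → (λ e → ¬hit (j , inj₁ e)) , λ e → ¬hit (j , inj₂ e)
    ... | yes all with i , j , i<j , same ← pigeonhole (ℕ.n<1+n k) (proj₁ ∘ all) =
      contradiction
        (cong toℕ (hit-unique i j (proj₂ (all i)) (subst (Hit j ∘ z) (sym same) (proj₂ (all j)))))
        (ℕ.<⇒≢ i<j)

  -- An element x added to both coordinate lists contributes a hook of 2x + 1 cells.
  Filler : List ℕ → ℕ → Set
  Filler zs L = ∃[ X ] Unique X × All (λ x → All (_≢ x) zs) X × sum X + sum X + length X ≡ L

  module _ (b s : ℕ) (s<b : s < b) where

    private
      forbidden : List ℕ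
      forbidden = b ∷ s ∷ pred s ∷ 0 ∷ []

      free-below : ∀ {x} → 0 < x → x < pred s → All (_≢ x) forbidden
      free-below 0<x x<s = ℕ.>⇒≢ (ℕ.<-≤-trans x<s (ℕ.≤-trans ℕ.pred[n]≤n (ℕ.<⇒≤ s<b))) ∷
        ℕ.>⇒≢ (ℕ.<-≤-trans x<s ℕ.pred[n]≤n) ∷ ℕ.>⇒≢ x<s ∷ ℕ.<⇒≢ 0<x ∷ []

    -- Two hooks with `x + y = m`. Three forbidden values have to be avoided, hence four disjoint
    -- pairs and the bound 8; the fourth value 0 is excluded by positivity.
    filler-even : ∀ m → 8 < m → Filler forbidden (2 + 2 * m)
    filler-even m 8<m
      with x , y , 0<x , x<y , refl , free ← pairAvoiding 8<m (lookup (b ∷ s ∷ pred s ∷ [])) =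
      x ∷ y ∷ [] , (ℕ.<⇒≢ x<y ∷ []) ∷ [] ∷ [] ,
      (proj₁ (free zero) ∷ proj₁ (free (suc zero)) ∷ proj₁ (free (suc (suc zero))) ∷ ℕ.<⇒≢ 0<x ∷ []) ∷
      (proj₂ (free zero) ∷ proj₂ (free (suc zero)) ∷ proj₂ (free (suc (suc zero))) ∷
        ℕ.<⇒≢ (ℕ.<-trans 0<x x<y) ∷ []) ∷ [] ,
      lemma x y
      where
      lemma : ∀ x y → x + (y + 0) + (x + (y + 0)) + 2 ≡ 2 + 2 * (x + y)
      lemma = solveℕ-∀

    private
      triple : ∀ x y z {m} → suc (x + y + z) ≡ m → x < y → y < z →
        All (λ x → All (_≢ x) forbidden) (x ∷ y ∷ z ∷ []) → Filler forbidden (1 + 2 * m)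
      triple x y z refl x<y y<z free = x ∷ y ∷ z ∷ [] ,
        (ℕ.<⇒≢ x<y ∷ ℕ.<⇒≢ (ℕ.<-trans x<y y<z) ∷ []) ∷ (ℕ.<⇒≢ y<z ∷ []) ∷ [] ∷ [] ,
        free , lemma x y z
        where
        lemma : ∀ x y z →
          x + (y + (z + 0)) + (x + (y + (z + 0))) + 3 ≡ 1 + 2 * suc (x + y + z)
        lemma = solveℕ-∀

      -- For `m = 9 + t` the three parts add up to `m - 1`. All are positive and below `pred s`,
      -- hence also differ from `s` and `b`.
      filler-odd-s : ∀ t → 8 + t ℕ.≤ pred s → Filler forbidden (1 + 2 * (9 + t))
      filler-odd-s t p = triple 1 2 (5 + t) refl (s<s z<s) (s<s (s<s z<s))
        (free-below z<s (ℕ.≤-trans (s≤s (s≤s z≤n)) p) ∷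
         free-below z<s (ℕ.≤-trans (s≤s (s≤s (s≤s z≤n))) p) ∷
         free-below z<s (ℕ.≤-trans (ℕ.+-monoˡ-≤ t {6} {8} (ℕ.m≤m+n 6 2)) p) ∷ [])

      -- The parts 1, 2, `5 + t` can collide only with `s` or `pred s` in the last one. In that case
      -- `s` is large enough for 2, 3, `3 + t` to lie below `pred s`.
      filler-odd-b : ∀ t → b ≡ 9 + t → 7 ℕ.≤ pred s → Filler forbidden (1 + 2 * (9 + t))
      filler-odd-b t b≡m 7≤s-1 = cases (5 + t ℕ.≟ s) (5 + t ℕ.≟ pred s)
        where
        minus6 : 4 + t ℕ.≤ pred s → 7 ℕ.≤ 5 + t → Filler forbidden (1 + 2 * (9 + t))
        minus6 p (s≤s (s≤s q)) = triple 2 3 (3 + t) refl (s<s (s<s z<s)) (ℕ.<⇒≤ q)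
          (free-below z<s (ℕ.≤-trans (ℕ.m≤m+n 3 4) 7≤s-1) ∷
           free-below z<s (ℕ.≤-trans (ℕ.m≤m+n 4 3) 7≤s-1) ∷
           free-below z<s p ∷ [])
        cases : Dec (5 + t ≡ s) → Dec (5 + t ≡ pred s) → Filler forbidden (1 + 2 * (9 + t))
        cases (no ≢s) (no ≢s-1) = triple 1 2 (5 + t) refl (s<s z<s) (s<s (s<s z<s))
          (free-below z<s (ℕ.≤-trans (ℕ.m≤m+n 2 5) 7≤s-1) ∷
           free-below z<s (ℕ.≤-trans (ℕ.m≤m+n 3 4) 7≤s-1) ∷
           ((λ b≡ → ℕ.<⇒≢ (ℕ.+-monoˡ-< t {5} {9} (ℕ.m≤m+n 6 3)) (trans (sym b≡) b≡m)) ∷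
             (≢s ∘ sym) ∷ (≢s-1 ∘ sym) ∷ (λ ()) ∷ []) ∷ [])
        cases (yes ≡s) _ = minus6 (ℕ.≤-reflexive (cong pred ≡s))
          (ℕ.≤-trans 7≤s-1 (ℕ.≤-trans ℕ.pred[n]≤n (ℕ.≤-reflexive (sym ≡s))))
        cases _ (yes ≡s-1) = minus6 (ℕ.≤-trans (ℕ.n≤1+n (4 + t)) (ℕ.≤-reflexive ≡s-1))
          (ℕ.≤-trans 7≤s-1 (ℕ.≤-reflexive (sym ≡s-1)))

    -- With 2m + 1 cells use {m}, unless m is forbidden; then split m - 1 into three parts.
    filler-odd : ∀ m → 8 < m → b + 8 ℕ.≤ m + s → Filler forbidden (1 + 2 * m)
    filler-odd m 8<m b+8≤m+s with t , refl ← ℕ.m≤n⇒∃[o]m+o≡n 8<m =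
      cases (m ℕ.≟ b) (m ℕ.≟ s) (m ℕ.≟ pred s)
      where
      cases : Dec (m ≡ b) → Dec (m ≡ s) → Dec (m ≡ pred s) → Filler forbidden (1 + 2 * m)
      cases (yes m≡b) _ _ = filler-odd-b t (sym m≡b)
        (ℕ.pred-mono-≤ (ℕ.+-cancelˡ-≤ b 8 s (subst (λ c → b + 8 ℕ.≤ c + s) m≡b b+8≤m+s)))
      cases _ (yes m≡s) _ = filler-odd-s t (ℕ.≤-reflexive (cong pred m≡s))
      cases _ _ (yes m≡s-1) = filler-odd-s t (ℕ.≤-trans (ℕ.n≤1+n (8 + t)) (ℕ.≤-reflexive m≡s-1))
      cases (no m≢b) (no m≢s) (no m≢s-1) = m ∷ [] , [] ∷ [] ,
        ((m≢b ∘ sym) ∷ (m≢s ∘ sym) ∷ (m≢s-1 ∘ sym) ∷ (λ ()) ∷ []) ∷ [] , lemma m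
        where
        lemma : ∀ m → m + 0 + (m + 0) + 1 ≡ suc (2 * m)
        lemma = solveℕ-∀

    private
      b+8≤⇒8< : ∀ m → b + 8 ℕ.≤ m + s → 8 < m
      b+8≤⇒8< m b+8≤m+s =
        ℕ.+-cancelʳ-< s 8 m (ℕ.<-≤-trans (subst (8 + s <_) (ℕ.+-comm 8 b) (ℕ.+-monoʳ-< 8 s<b)) b+8≤m+s)

    -- For `L = 2m + 2` as for `L = 2m + 1` the bound amounts to `b + 8 ≤ m + s`, and `s < b` turns
    -- this into `8 < m`.
    filler : ∀ L → 2 * (b + 8) < L + 2 * s → Filler forbidden L
    filler L large with parity L
    ... | m , inj₁ refl = even m (ℕ.*-cancelˡ-< 2 (b + 8) (m + s)
        (subst (2 * (b + 8) <_) (sym (ℕ.*-distribˡ-+ 2 m s)) large))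
      where
      even : ∀ m → b + 8 < m + s → Filler forbidden (2 * m)
      even zero b+8<s = contradiction (ℕ.<-trans b+8<s s<b) (ℕ.m+n≮m b 8)
      even (suc m) b+8<m+s = subst (Filler forbidden) (sym (ℕ.*-suc 2 m))
        (filler-even m (b+8≤⇒8< m (ℕ.≤-pred b+8<m+s)))
    ... | m , inj₂ refl = filler-odd m (b+8≤⇒8< m b+8≤m+s) b+8≤m+s
      where
      b+8≤m+s : b + 8 ℕ.≤ m + s
      b+8≤m+s = ℕ.*-cancelˡ-≤ 2 (ℕ.≤-trans (ℕ.≤-pred large) (ℕ.≤-reflexive (sym (ℕ.*-distribˡ-+ 2 m s))))

  -- `X` avoids `b` and `pred s` as arms, `s` and 0 as legs. The triangular numbers of `s - 1` and
  -- `s` differ by `s`, which leaves the content `k`; the unfilled shape has `b + 2s + 1` cells,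
  -- also for `s = 0`.
  coordinates-filled : ∀ b s k L → s < b → k + s ≡ triangle b →
    Filler (b ∷ s ∷ pred s ∷ 0 ∷ []) L → Coordinates (b + (2 * s + 1) + L) k
  coordinates-filled b zero k L 0<b k≡ (X , uniq , free , cells) =
    b ∷ X , 0 ∷ X , All.map All.head free ∷ uniq , All.map (All.head ∘ All.tail) free ∷ uniq , refl ,
    trans (lemma₁ b (sum X) (length X)) (cong (_+_ (b + 1)) cells) ,
    cong (_+ sum (map triangle X)) (trans (sym k≡) (ℕ.+-identityʳ k))
    where
    lemma₁ : ∀ b x l → b + x + x + suc l ≡ b + 1 + (x + x + l)
    lemma₁ = solveℕ-∀
  coordinates-filled b (suc s) k L s<b k≡ (X , uniq , free , cells) =
    b ∷ s ∷ X , suc s ∷ 0 ∷ X ,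
    (ℕ.>⇒≢ (ℕ.<⇒≤ s<b) ∷ All.map All.head free) ∷ All.map (All.head ∘ All.tail ∘ All.tail) free ∷ uniq ,
    ((λ ()) ∷ All.map (All.head ∘ All.tail) free) ∷
      All.map (All.head ∘ All.tail ∘ All.tail ∘ All.tail) free ∷ uniq ,
    refl ,
    trans (lemma₁ b s (sum X) (length X)) (cong (_+_ (b + (2 * suc s + 1))) cells) ,
    trans (cong (_+ (triangle s + T)) (sym k≡)) (lemma₂ k (suc s) (triangle s) T)
    where
    T = sum (map triangle X)
    lemma₁ : ∀ b s x l → b + (s + x) + (suc s + x) + suc (suc l) ≡ b + (2 * suc s + 1) + (x + x + l)
    lemma₁ = solveℕ-∀
    lemma₂ : ∀ k s t x → k + s + (t + x) ≡ k + (s + t + x)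
    lemma₂ = solveℕ-∀

  choose₂-mono : ∀ {m n} → m ℕ.≤ n → choose₂ m ℕ.≤ choose₂ n
  choose₂-mono z≤n = z≤n
  choose₂-mono (s≤s m≤n) = ℕ.+-mono-≤ m≤n (choose₂-mono m≤n)

  choose₂≡C : ∀ n → choose₂ n ≡ n C 2
  choose₂≡C zero = refl
  choose₂≡C (suc n) = begin
    n + choose₂ n  ≡⟨ cong₂ _+_ (sym (nC1≡n n)) (choose₂≡C n) ⟩
    n C 1 + n C 2  ≡⟨ nCk+nC[k+1]≡[n+1]C[k+1] n 1 ⟩
    suc n C 2      ∎
    where open ≡-Reasoning

  coordinates : ∀ n q k → 15 + 3 * q ℕ.≤ n → k ℕ.≤ choose₂ q → Coordinates n k
  -- `triangularCeiling` represents only positive numbers.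
  coordinates n q zero large _ = coordinates-zero n (ℕ.m+n≤o⇒m≤o 3 large)
  coordinates n q (suc k) large k≤ with b , s , s<b , k+s≡ ← triangularCeiling k =
    subst (λ n → Coordinates n (suc k)) (ℕ.m+[n∸m]≡n size≤n)
      (coordinates-filled b s (suc k) L s<b k+s≡ (filler b s s<b L L-large))
    where
    open ℕ.≤-Reasoning
    size = b + (2 * s + 1)
    L = n ∸ size
    b<q : b < q
    -- If `q ≤ b`, then `suc k ≤ choose₂ b`, which is `triangle b - b`, so the deficit `s` would be
    -- at least `b`.
    b<q = ℕ.≰⇒> λ q≤b → ℕ.<⇒≱ s<b (ℕ.+-cancelˡ-≤ (suc k) b s (begin
      suc k + b      ≤⟨ ℕ.+-monoˡ-≤ b (ℕ.≤-trans k≤ (choose₂-mono q≤b)) ⟩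
      choose₂ b + b  ≡⟨ ℕ.+-comm (choose₂ b) b ⟩
      triangle b     ≡⟨ k+s≡ ⟨
      suc k + s      ∎))
    -- The origin of 15 and 3: with `size` added, the bound of `filler` becomes `3b + 18 ≤ n`, and
    -- `3b + 18 = 15 + 3(b + 1)`.
    total : 2 * (b + 8) + (b + 2) ℕ.≤ n
    total = begin
      2 * (b + 8) + (b + 2)  ≡⟨ trans (lemma b 8) (cong (_+_ 15) (sym (ℕ.*-suc 3 b))) ⟩
      15 + 3 * suc b         ≤⟨ ℕ.+-monoʳ-≤ 15 (ℕ.*-monoʳ-≤ 3 b<q) ⟩
      15 + 3 * q             ≤⟨ large ⟩
      n                      ∎
      where
      lemma : ∀ b c → 2 * (b + c) + (b + 2) ≡ 2 * c + 2 + 3 * b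
      lemma = solveℕ-∀
    size≤n : size ℕ.≤ n
    size≤n = begin
      b + (2 * s + 1)               ≤⟨ ℕ.+-monoʳ-≤ b (ℕ.+-monoˡ-≤ 1 (ℕ.*-monoʳ-≤ 2 (ℕ.<⇒≤ s<b))) ⟩
      b + (2 * b + 1)               ≤⟨ ℕ.m≤m+n _ 17 ⟩
      b + (2 * b + 1) + 17          ≡⟨ lemma b 8 ⟩
      2 * (b + 8) + (b + 2)         ≤⟨ total ⟩
      n                             ∎
      where
      lemma : ∀ b c → b + (2 * b + 1) + (2 * c + 1) ≡ 2 * (b + c) + (b + 2)
      lemma = solveℕ-∀
    L-large : 2 * (b + 8) < L + 2 * s
    L-large = ℕ.+-cancelʳ-≤ (b + 1) _ _ (begin
      suc (2 * (b + 8)) + (b + 1)   ≡⟨ lemma₁ (2 * (b + 8)) b ⟩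
      2 * (b + 8) + (b + 2)         ≤⟨ total ⟩
      n                             ≡⟨ ℕ.m∸n+n≡m size≤n ⟨
      L + size                      ≡⟨ lemma₂ L b s ⟩
      L + 2 * s + (b + 1)           ∎)
      where
      lemma₁ : ∀ c b → suc c + (b + 1) ≡ c + (b + 2)
      lemma₁ = solveℕ-∀
      lemma₂ : ∀ L b s → L + (b + (2 * s + 1)) ≡ L + 2 * s + (b + 1)
      lemma₂ = solveℕ-∀

-- Determinants and Specht functions on words

open import Data.Integer using (_+_; _*_; _-_)

Word : Set
Word = List ℕ

-- The Laplace expansion Σᵢ (-1)ⁱ p(xᵢ) F(x without xᵢ).
D : (ℕ → ℤ) → (Word → ℤ) → Word → ℤ
D p F [] = 0ℤ
D p F (x ∷ xs) = p x * F xs - D p (F ∘ (x ∷_)) xs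

D-zeroʳ : ∀ p {F} → (∀ xs → F xs ≡ 0ℤ) → ∀ xs → D p F xs ≡ 0ℤ
D-zeroʳ p F≗0 [] = refl
D-zeroʳ p F≗0 (x ∷ xs) = trans
  (cong₂ (λ a b → p x * a - b) (F≗0 xs) (D-zeroʳ p (F≗0 ∘ (x ∷_)) xs))
  (lemma (p x))
  where
  lemma : ∀ a → a * 0ℤ - 0ℤ ≡ 0ℤ
  lemma = solve-∀

D-zeroˡ : ∀ {p} F → (∀ x → p x ≡ 0ℤ) → ∀ xs → D p F xs ≡ 0ℤ
D-zeroˡ F p≗0 [] = refl
D-zeroˡ F p≗0 (x ∷ xs) = trans
  (cong₂ (λ a b → a * F xs - b) (p≗0 x) (D-zeroˡ (F ∘ (x ∷_)) p≗0 xs))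
  (lemma (F xs))
  where
  lemma : ∀ a → 0ℤ * a - 0ℤ ≡ 0ℤ
  lemma = solve-∀

D-linearʳ : ∀ p c F G xs →
  D p (λ ys → c * F ys - G ys) xs ≡ c * D p F xs - D p G xs
D-linearʳ p c F G [] = lemma c
  where
  lemma : ∀ c → 0ℤ ≡ c * 0ℤ - 0ℤ
  lemma = solve-∀
D-linearʳ p c F G (x ∷ xs) = trans
  (cong (_-_ (p x * (c * F xs - G xs))) (D-linearʳ p c (F ∘ (x ∷_)) (G ∘ (x ∷_)) xs))
  (lemma c (p x) (F xs) (G xs) (D p (F ∘ (x ∷_)) xs) (D p (G ∘ (x ∷_)) xs))
  where
  lemma : ∀ c p f g f′ g′ →
    p * (c * f - g) - (c * f′ - g′) ≡ c * (p * f - f′) - (p * g - g′)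
  lemma = solve-∀

D-linearˡ : ∀ {p q r} c F → (∀ x → p x ≡ q x + c * r x) →
  ∀ xs → D p F xs ≡ D q F xs + c * D r F xs
D-linearˡ c F p≗ [] = lemma c
  where
  lemma : ∀ c → 0ℤ ≡ 0ℤ + c * 0ℤ
  lemma = solve-∀
D-linearˡ {p} {q} {r} c F p≗ (x ∷ xs) = trans
  (cong₂ (λ a b → a * F xs - b) (p≗ x) (D-linearˡ c (F ∘ (x ∷_)) p≗ xs))
  (lemma c (q x) (r x) (F xs) (D q (F ∘ (x ∷_)) xs) (D r (F ∘ (x ∷_)) xs))
  where
  lemma : ∀ c q r f q′ r′ →
    (q + c * r) * f - (q′ + c * r′) ≡ (q * f - q′) + c * (r * f - r′)
  lemma = solve-∀

-- `D p` is the wedge product with the linear form `p`, so this is the exchange of two rows;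
-- `D-square` is the case of two equal rows.
D-anticomm : ∀ p q F xs → D p (D q F) xs ≡ - D q (D p F) xs
D-anticomm p q F [] = refl
D-anticomm p q F (x ∷ xs) = begin
  p x * D q F xs - D p (λ ys → q x * F ys - D q Fₓ ys) xs
    ≡⟨ cong (_-_ (p x * D q F xs)) (D-linearʳ p (q x) F (D q Fₓ) xs) ⟩
  p x * D q F xs - (q x * D p F xs - D p (D q Fₓ) xs)
    ≡⟨ cong (λ z → p x * D q F xs - (q x * D p F xs - z)) (D-anticomm p q Fₓ xs) ⟩
  p x * D q F xs - (q x * D p F xs - (- D q (D p Fₓ) xs))
    ≡⟨ lemma (p x) (q x) (D p F xs) (D q F xs) (D q (D p Fₓ) xs) ⟩
  - (q x * D p F xs - (p x * D q F xs - D q (D p Fₓ) xs))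
    ≡⟨ cong (λ z → - (q x * D p F xs - z)) (D-linearʳ q (p x) F (D p Fₓ) xs) ⟨
  - (q x * D p F xs - D q (λ ys → p x * F ys - D p Fₓ ys) xs) ∎
  where
  open ≡-Reasoning
  Fₓ : Word → ℤ
  Fₓ = F ∘ (x ∷_)
  lemma : ∀ p q a b c → p * b - (q * a - (- c)) ≡ - (q * a - (p * b - c))
  lemma = solve-∀

D-square : ∀ p F xs → D p (D p F) xs ≡ 0ℤ
D-square p F [] = refl
D-square p F (x ∷ xs) = begin
  p x * D p F xs - D p (λ ys → p x * F ys - D p Fₓ ys) xs
    ≡⟨ cong (_-_ (p x * D p F xs)) (D-linearʳ p (p x) F (D p Fₓ) xs) ⟩
  p x * D p F xs - (p x * D p F xs - D p (D p Fₓ) xs)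
    ≡⟨ cong (λ z → p x * D p F xs - (p x * D p F xs - z)) (D-square p Fₓ xs) ⟩
  p x * D p F xs - (p x * D p F xs - 0ℤ)
    ≡⟨ lemma (p x * D p F xs) ⟩
  0ℤ ∎
  where
  open ≡-Reasoning
  Fₓ : Word → ℤ
  Fₓ = F ∘ (x ∷_)
  lemma : ∀ a → a - (a - 0ℤ) ≡ 0ℤ
  lemma = solve-∀

Alternating : (Word → ℤ) → Set
Alternating F = ∀ ws x y zs → F (ws ++ x ∷ y ∷ zs) ≡ - F (ws ++ y ∷ x ∷ zs)

D-neg : ∀ p {F G} → (∀ xs → F xs ≡ - G xs) → ∀ xs → D p F xs ≡ - D p G xs
D-neg p F≗-G [] = refl
D-neg p {F} {G} F≗-G (x ∷ xs) = trans
  (cong₂ (λ a b → p x * a - b) (F≗-G xs) (D-neg p (F≗-G ∘ (x ∷_)) xs))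
  (lemma (p x) (G xs) (D p (G ∘ (x ∷_)) xs))
  where
  lemma : ∀ p a b → p * (- a) - (- b) ≡ - (p * a - b)
  lemma = solve-∀

-- Exchanging `x` and `y` trades the two terms that delete one of them, which have opposite signs;
-- every other term keeps both letters and changes sign through `F`.
D-alternating : ∀ p F → Alternating F → Alternating (D p F)
D-alternating p F alt [] x y zs = trans
  (cong (λ d → p x * F (y ∷ zs) - (p y * F (x ∷ zs) - d)) (D-neg p (λ ws → alt [] x y ws) zs))
  (lemma (p x * F (y ∷ zs)) (p y * F (x ∷ zs)) (D p (λ ws → F (y ∷ x ∷ ws)) zs))
  where
  lemma : ∀ a b c → a - (b - (- c)) ≡ - (b - (a - c))
  lemma = solve-∀
D-alternating p F alt (w ∷ ws) x y zs = trans
  (cong₂ (λ a b → p w * a - b) (alt ws x y zs)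
    (D-alternating p (F ∘ (w ∷_)) (alt ∘ (w ∷_)) ws x y zs))
  (lemma (p w) (F (ws ++ y ∷ x ∷ zs)) (D p (F ∘ (w ∷_)) (ws ++ y ∷ x ∷ zs)))
  where
  lemma : ∀ p a b → p * (- a) - (- b) ≡ - (p * a - b)
  lemma = solve-∀

VanishesAbove : ℕ → (Word → ℤ) → Set
VanishesAbove m F = ∀ u → Any (m ℕ.≤_) u → F u ≡ 0ℤ

δ : ℕ → ℕ → ℤ
δ a x = if does (x ℕ.≟ a) then 1ℤ else 0ℤ

δ-refl : ∀ a → δ a a ≡ 1ℤ
δ-refl a = cong (if_then 1ℤ else 0ℤ) (dec-true (a ℕ.≟ a) refl)

δ-≢ : ∀ {a x} → x ≢ a → δ a x ≡ 0ℤ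
δ-≢ {a} {x} x≢a = cong (if_then 1ℤ else 0ℤ) (dec-false (x ℕ.≟ a) x≢a)

indicator[] : Word → ℤ
indicator[] [] = 1ℤ
indicator[] (_ ∷ _) = 0ℤ

-- The determinant with rows `δ (m - 1)`, ..., `δ 0` and one column per letter. It is 0 on words of
-- length other than `m`, and the sign is normalised by `descending m`.
det : ℕ → Word → ℤ
det zero = indicator[]
det (suc m) = D (δ m) (det m)

det-alternating : ∀ m → Alternating (det m)
det-alternating zero [] x y zs = refl
det-alternating zero (_ ∷ ws) x y zs = refl
det-alternating (suc m) = D-alternating (δ m) (det m) (det-alternating m)

D-vanishesAbove : ∀ m F → VanishesAbove m F → VanishesAbove (suc m) (D (δ m) F)
D-vanishesAbove m F van (x ∷ xs) (here m<x) = trans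
  (cong₂ (λ a b → a * F xs - b) (δ-≢ (ℕ.>⇒≢ m<x))
    (D-zeroʳ (δ m) (λ ys → van (x ∷ ys) (here (ℕ.<⇒≤ m<x))) xs))
  (lemma (F xs))
  where
  lemma : ∀ a → 0ℤ * a - 0ℤ ≡ 0ℤ
  lemma = solve-∀
D-vanishesAbove m F van (x ∷ xs) (there any) = trans
  (cong₂ (λ a b → δ m x * a - b) (van xs (Any.map ℕ.<⇒≤ any))
    (D-vanishesAbove m (F ∘ (x ∷_)) (λ u → van (x ∷ u) ∘ there) xs any))
  (lemma (δ m x))
  where
  lemma : ∀ a → a * 0ℤ - 0ℤ ≡ 0ℤ
  lemma = solve-∀

det-vanishesAbove : ∀ m → VanishesAbove m (det m)
det-vanishesAbove zero (_ ∷ _) _ = refl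
det-vanishesAbove (suc m) = D-vanishesAbove m (det m) (det-vanishesAbove m)

-- A matrix of size m + 1 whose last row is a combination of the others is singular.
D-det≡0 : ∀ m g → (∀ x → m ℕ.≤ x → g x ≡ 0ℤ) → ∀ xs → D g (det m) xs ≡ 0ℤ
D-det≡0 zero g g≡0 = D-zeroˡ (det zero) (λ x → g≡0 x z≤n)
D-det≡0 (suc m) g g≡0 xs = begin
  D g (det (suc m)) xs
    ≡⟨ D-linearˡ (g m) (det (suc m)) split xs ⟩
  D g′ (D (δ m) (det m)) xs + g m * D (δ m) (D (δ m) (det m)) xs
    ≡⟨ cong₂ (λ a b → a + g m * b) (D-anticomm g′ (δ m) (det m) xs) (D-square (δ m) (det m) xs) ⟩
  - D (δ m) (D g′ (det m)) xs + g m * 0ℤ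
    ≡⟨ cong (λ a → - a + g m * 0ℤ) (D-zeroʳ (δ m) (D-det≡0 m g′ g′≡0) xs) ⟩
  - 0ℤ + g m * 0ℤ
    ≡⟨ lemma (g m) ⟩
  0ℤ ∎
  where
  open ≡-Reasoning
  -- Row reduction: subtracting a multiple of the row `δ m` makes `g` vanish at `m` too. The
  -- multiple dies by `D-square`; anticommuting moves `g′` inside, onto `det m`, where induction
  -- applies.
  g′ : ℕ → ℤ
  g′ x = g x - g m * δ m x
  split : ∀ x → g x ≡ g′ x + g m * δ m x
  split x = cancel (g x) (g m * δ m x)
    where
    cancel : ∀ a b → a ≡ a - b + b
    cancel = solve-∀
  g′≡0 : ∀ x → m ℕ.≤ x → g′ x ≡ 0ℤ
  g′≡0 x m≤x with x ℕ.≟ m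
  ... | yes refl = trans (cong (λ d → g x - g x * d) (δ-refl x)) (cancel (g x))
    where
    cancel : ∀ a → a - a * 1ℤ ≡ 0ℤ
    cancel = solve-∀
  ... | no x≢m = trans
    (cong₂ (λ a d → a - g m * d) (g≡0 x (ℕ.≤∧≢⇒< m≤x (x≢m ∘ sym))) (δ-≢ x≢m))
    (cancel (g m))
    where
    cancel : ∀ a → 0ℤ - a * 0ℤ ≡ 0ℤ
    cancel = solve-∀
  lemma : ∀ a → - 0ℤ + a * 0ℤ ≡ 0ℤ
  lemma = solve-∀

descending : ℕ → Word
descending zero = []
descending (suc m) = m ∷ descending m

-- Only the leading term of the expansion survives: all others leave the letter `m` in an argument
-- of `det m`.
det-descending : ∀ m → det m (descending m) ≡ 1ℤ
det-descending zero = refl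
det-descending (suc m) = cong₂ (λ a b → a - b)
  (cong₂ _*_ (δ-refl m) (det-descending m))
  (D-zeroʳ (δ m) (λ ys → det-vanishesAbove m (m ∷ ys) (here ℕ.≤-refl)) (descending m))

-- Sums over exchanges of letters

-- swapHead f x u sums f a w over all ways to exchange x with a letter a of u,
-- w being the word u after the exchange.
swapHead : (ℕ → Word → ℤ) → ℕ → Word → ℤ
swapHead f x [] = 0ℤ
swapHead f x (y ∷ ys) = f y (x ∷ ys) + swapHead (λ a zs → f a (y ∷ zs)) x ys

swapAll : (Word → ℤ) → Word → ℤ
swapAll f [] = 0ℤ
swapAll f (x ∷ xs) = swapHead (λ a zs → f (a ∷ zs)) x xs + swapAll (f ∘ (x ∷_)) xs

swapHead-cong : ∀ {f g} x u → (∀ a w → length w ≡ length u → f a w ≡ g a w) →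
  swapHead f x u ≡ swapHead g x u
swapHead-cong x [] f≗g = refl
swapHead-cong x (y ∷ ys) f≗g = cong₂ _+_ (f≗g y (x ∷ ys) refl)
  (swapHead-cong x ys (λ a w → f≗g a (y ∷ w) ∘ cong suc))

swapAll-cong : ∀ {f g} u → (∀ w → length w ≡ length u → f w ≡ g w) →
  swapAll f u ≡ swapAll g u
swapAll-cong [] f≗g = refl
swapAll-cong (x ∷ xs) f≗g = cong₂ _+_
  (swapHead-cong x xs (λ a w → f≗g (a ∷ w) ∘ cong suc))
  (swapAll-cong xs (λ w → f≗g (x ∷ w) ∘ cong suc))

swapHead-* : ∀ c f x u → swapHead (λ a w → c * f a w) x u ≡ c * swapHead f x u
swapHead-* c f x [] = sym (ℤ.*-zeroʳ c)
swapHead-* c f x (y ∷ ys) = trans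
  (cong (_+_ (c * f y (x ∷ ys))) (swapHead-* c (λ a zs → f a (y ∷ zs)) x ys))
  (sym (ℤ.*-distribˡ-+ c _ _))

swapAll-* : ∀ c f u → swapAll (λ w → c * f w) u ≡ c * swapAll f u
swapAll-* c f [] = sym (ℤ.*-zeroʳ c)
swapAll-* c f (x ∷ xs) = trans
  (cong₂ _+_ (swapHead-* c (λ a w → f (a ∷ w)) x xs) (swapAll-* c (f ∘ (x ∷_)) xs))
  (sym (ℤ.*-distribˡ-+ c _ _))

swapHead-++ : ∀ f x us vs → swapHead f x (us ++ vs) ≡
  swapHead (λ a w → f a (w ++ vs)) x us + swapHead (λ a w → f a (us ++ w)) x vs
swapHead-++ f x [] vs = sym (ℤ.+-identityˡ _)
swapHead-++ f x (u ∷ us) vs = trans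
  (cong (_+_ (f u (x ∷ us ++ vs))) (swapHead-++ (λ a w → f a (u ∷ w)) x us vs))
  (sym (ℤ.+-assoc (f u (x ∷ us ++ vs)) _ _))

swapAcross : (Word → Word → ℤ) → Word → Word → ℤ
swapAcross f [] vs = 0ℤ
swapAcross f (u ∷ us) vs =
  swapHead (λ a w → f (a ∷ us) w) u vs + swapAcross (f ∘ (u ∷_)) us vs

swapAll-++ : ∀ f us vs → swapAll f (us ++ vs) ≡
  swapAll (λ w → f (w ++ vs)) us + swapAcross (λ w z → f (w ++ z)) us vs
    + swapAll (λ w → f (us ++ w)) vs
swapAll-++ f [] vs = sym (ℤ.+-identityˡ _)
swapAll-++ f (u ∷ us) vs = trans
  (cong₂ _+_ (swapHead-++ (λ a w → f (a ∷ w)) u us vs) (swapAll-++ (f ∘ (u ∷_)) us vs))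
  (lemma (swapHead (λ a w → f (a ∷ w ++ vs)) u us) _ _ _ _)
  where
  lemma : ∀ a b c d e → (a + b) + (c + d + e) ≡ a + c + (b + d) + e
  lemma = solve-∀

swapAcross-cong : ∀ {f g} us vs → (∀ w z → length w ≡ length us → f w z ≡ g w z) →
  swapAcross f us vs ≡ swapAcross g us vs
swapAcross-cong [] vs f≗g = refl
swapAcross-cong (u ∷ us) vs f≗g = cong₂ _+_
  (swapHead-cong u vs (λ a w _ → f≗g (a ∷ us) w refl))
  (swapAcross-cong us vs (λ w z → f≗g (u ∷ w) z ∘ cong suc))

-- Each exchange changes the sign. `Alternating` speaks of neighbours only, so the first letter is
-- moved past `y`, induction is applied to `F ∘ (y ∷_)`, and the letter is moved back.
swapHead-alternating : ∀ F → Alternating F → ∀ x xs →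
  swapHead (λ a w → F (a ∷ w)) x xs ≡ - (+ length xs) * F (x ∷ xs)
swapHead-alternating F alt x [] = sym (ℤ.*-zeroˡ (F (x ∷ [])))
swapHead-alternating F alt x (y ∷ ys) = begin
  F (y ∷ x ∷ ys) + swapHead (λ a w → F (a ∷ y ∷ w)) x ys
    ≡⟨ cong₂ _+_ (alt [] y x ys)
         (trans (swapHead-cong x ys λ a w _ → trans (alt [] a y w) (sym (ℤ.-1*i≡-i _)))
           (swapHead-* (- 1ℤ) (λ a w → F (y ∷ a ∷ w)) x ys)) ⟩
  - F (x ∷ y ∷ ys) + - 1ℤ * swapHead (λ a w → F (y ∷ a ∷ w)) x ys
    ≡⟨ cong (λ z → - F (x ∷ y ∷ ys) + - 1ℤ * z)
         (trans (swapHead-alternating (F ∘ (y ∷_)) (alt ∘ (y ∷_)) x ys)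
           (cong (- (+ length ys) *_) (alt [] y x ys))) ⟩
  - F (x ∷ y ∷ ys) + - 1ℤ * (- (+ length ys) * - F (x ∷ y ∷ ys))
    ≡⟨ lemma (F (x ∷ y ∷ ys)) (+ length ys) ⟩
  - (+ 1 + + length ys) * F (x ∷ y ∷ ys) ∎
  where
  open ≡-Reasoning
  lemma : ∀ f n → - f + - 1ℤ * (- n * - f) ≡ - (+ 1 + n) * f
  lemma = solve-∀

swapAll-alternating : ∀ F → Alternating F → ∀ xs →
  swapAll F xs ≡ - (+ choose₂ (length xs)) * F xs
swapAll-alternating F alt [] = sym (ℤ.*-zeroˡ (F []))
swapAll-alternating F alt (x ∷ xs) = trans
  (cong₂ _+_ (swapHead-alternating F alt x xs) (swapAll-alternating (F ∘ (x ∷_)) (alt ∘ (x ∷_)) xs))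
  (lemma (+ length xs) (+ choose₂ (length xs)) (F (x ∷ xs)))
  where
  lemma : ∀ n c f → - n * f + - c * f ≡ - (n + c) * f
  lemma = solve-∀

-- The sum in Cramer's rule: each letter `x` in turn is replaced by `y`, with weight `g x`.
replaceSum : (ℕ → ℤ) → ℕ → (Word → ℤ) → Word → ℤ
replaceSum g y F [] = 0ℤ
replaceSum g y F (x ∷ xs) = g x * F (y ∷ xs) + replaceSum g y (F ∘ (x ∷_)) xs

-- Moving `y` from the i-th place to the front costs the sign of the i-th Laplace term.
replaceSum≡D : ∀ g y F → Alternating F → ∀ xs →
  replaceSum g y F xs ≡ D g (F ∘ (y ∷_)) xs
replaceSum≡D g y F alt [] = refl
replaceSum≡D g y F alt (x ∷ xs) = cong (_+_ (g x * F (y ∷ xs))) (begin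
  replaceSum g y (F ∘ (x ∷_)) xs
    ≡⟨ replaceSum≡D g y (F ∘ (x ∷_)) (alt ∘ (x ∷_)) xs ⟩
  D g (λ ys → F (x ∷ y ∷ ys)) xs
    ≡⟨ D-neg g (alt [] x y) xs ⟩
  - D g (λ ys → F (y ∷ x ∷ ys)) xs ∎)
  where open ≡-Reasoning

-- Expand the singular determinant `D g (det m)` at `y ∷ xs`: the term of `y` is the right side, the
-- remaining ones form the left side.
cramer : ∀ m g → (∀ x → m ℕ.≤ x → g x ≡ 0ℤ) → ∀ y xs →
  replaceSum g y (det m) xs ≡ g y * det m xs
cramer m g g≡0 y xs = trans (replaceSum≡D g y (det m) (det-alternating m) xs)
  (sym (ℤ.i-j≡0⇒i≡j _ _ (D-det≡0 m g g≡0 (y ∷ xs))))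

-- `swapAcross` recurses on the first word, but Cramer's rule needs a fixed letter of the second.
-- This regroups the double sum by `v`.
swapAcross-∷ : ∀ (F G : Word → ℤ) us v vs →
  swapAcross (λ w z → F w * G z) us (v ∷ vs) ≡
  replaceSum (λ a → G (a ∷ vs)) v F us + swapAcross (λ w z → F w * G (v ∷ z)) us vs
swapAcross-∷ F G [] v vs = refl
swapAcross-∷ F G (u ∷ us) v vs = trans
  (cong (_+_ (F (v ∷ us) * G (u ∷ vs) + swapHead (λ a w → F (a ∷ us) * G (v ∷ w)) u vs))
    (swapAcross-∷ (F ∘ (u ∷_)) G us v vs))
  (lemma (F (v ∷ us)) (G (u ∷ vs)) (swapHead (λ a w → F (a ∷ us) * G (v ∷ w)) u vs) _ _)
  where
  lemma : ∀ f g a b c → f * g + a + (b + c) ≡ g * f + b + (a + c)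
  lemma = solve-∀

swapAcross-[] : ∀ f us → swapAcross f us [] ≡ 0ℤ
swapAcross-[] f [] = refl
swapAcross-[] f (u ∷ us) = trans (ℤ.+-identityˡ _) (swapAcross-[] (f ∘ (u ∷_)) us)

-- Each letter `v` contributes one copy of the product, by `cramer` with the weight `G (a ∷ vs)` of
-- the letter `a` that takes its place.
swapAcross-det : ∀ m G → VanishesAbove m G → ∀ us vs →
  swapAcross (λ w z → det m w * G z) us vs ≡ + length vs * (det m us * G vs)
swapAcross-det m G van us [] =
  trans (swapAcross-[] (λ w z → det m w * G z) us) (sym (ℤ.*-zeroˡ (det m us * G [])))
swapAcross-det m G van us (v ∷ vs) = trans (swapAcross-∷ (det m) G us v vs) (trans
  (cong₂ _+_ (cramer m (λ a → G (a ∷ vs)) (λ a m≤a → van (a ∷ vs) (here m≤a)) v us)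
    (swapAcross-det m (G ∘ (v ∷_)) (λ z → van (v ∷ z) ∘ there) us vs))
  (lemma (G (v ∷ vs)) (det m us) (+ length vs)))
  where
  lemma : ∀ g d n → g * d + n * (d * g) ≡ (+ 1 + n) * (d * g)
  lemma = solve-∀

-- Specht functions and contents of partitions

-- A partition is given by the list of its column lengths, in decreasing order.
Decreasing : ℕ → List ℕ → Set
Decreasing h [] = ⊤
Decreasing h (c ∷ cs) = c ℕ.≤ h × Decreasing c cs

specht : List ℕ → Word → ℤ
specht [] = indicator[]
specht (c ∷ cs) u = det c (take c u) * specht cs (drop c u)

-- The sum of column index minus row index over all cells: the first column gives 0, -1, ...,
-- `1 - c`, and putting it in front moves each later cell one column to the right.
content : List ℕ → ℤ
content [] = 0ℤ
content (c ∷ cs) = content cs + + sum cs - + choose₂ c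

VanishesAbove-mono : ∀ {m n F} → m ℕ.≤ n → VanishesAbove m F → VanishesAbove n F
VanishesAbove-mono m≤n van u any = van u (Any.map (ℕ.≤-trans m≤n) any)

specht-vanishesAbove : ∀ h cs → Decreasing h cs → VanishesAbove h (specht cs)
specht-vanishesAbove h [] _ (_ ∷ _) _ = refl
specht-vanishesAbove h (c ∷ cs) (c≤h , dec) u any
  with ++⁻ (take c u) (subst (Any (h ℕ.≤_)) (sym (take++drop≡id c u)) any)
... | inj₁ p = trans
  (cong (_* specht cs (drop c u)) (VanishesAbove-mono {F = det c} c≤h (det-vanishesAbove c) (take c u) p))
  (ℤ.*-zeroˡ (specht cs (drop c u)))
... | inj₂ p = trans
  (cong (det c (take c u) *_)
    (VanishesAbove-mono {F = specht cs} c≤h (specht-vanishesAbove c cs dec) (drop c u) p))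
  (ℤ.*-zeroʳ (det c (take c u)))

specht-++ : ∀ c cs us vs → length us ≡ c → specht (c ∷ cs) (us ++ vs) ≡ det c us * specht cs vs
specht-++ c cs us vs refl = cong₂ (λ a b → det c a * specht cs b) (take-++ us) (drop-++ us)
  where
  take-++ : ∀ ws → take (length ws) (ws ++ vs) ≡ ws
  take-++ [] = refl
  take-++ (w ∷ ws) = cong (w ∷_) (take-++ ws)
  drop-++ : ∀ ws → drop (length ws) (ws ++ vs) ≡ vs
  drop-++ [] = refl
  drop-++ (w ∷ ws) = drop-++ ws

-- Exchanges inside the first block, between it and the rest, and inside the rest give the three
-- terms of `content`. Decreasing columns make the rest vanish on letters from `c` on, as
-- `swapAcross-det` requires.
swapAll-specht : ∀ h cs → Decreasing h cs → ∀ u → length u ≡ sum cs →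
  swapAll (specht cs) u ≡ content cs * specht cs u
swapAll-specht h [] _ [] _ = refl
swapAll-specht h (c ∷ cs) (_ , dec) u |u| =
  subst (λ w → swapAll (specht (c ∷ cs)) w ≡ content (c ∷ cs) * specht (c ∷ cs) w)
    (take++drop≡id c u) (split (take c u) (drop c u) |take| |drop|)
  where
  open ≡-Reasoning

  |take| : length (take c u) ≡ c
  |take| = trans (length-take c u) (trans (cong (c ℕ.⊓_) |u|) (ℕ.m≤n⇒m⊓n≡m (ℕ.m≤m+n c (sum cs))))
  |drop| : length (drop c u) ≡ sum cs
  |drop| = trans (length-drop c u) (trans (cong (ℕ._∸ c) |u|) (ℕ.m+n∸m≡n c (sum cs)))
  f = specht (c ∷ cs)
  lemma : ∀ d g e s c → g * (- c * d) + s * (d * g) + d * (e * g) ≡ (e + s - c) * (d * g)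
  lemma = solve-∀
  split : ∀ us vs → length us ≡ c → length vs ≡ sum cs →
    swapAll f (us ++ vs) ≡ content (c ∷ cs) * f (us ++ vs)
  split us vs |us| |vs| = begin
    swapAll f (us ++ vs)
      ≡⟨ swapAll-++ f us vs ⟩
    swapAll (λ w → f (w ++ vs)) us + swapAcross (λ w z → f (w ++ z)) us vs
      + swapAll (λ w → f (us ++ w)) vs
      ≡⟨ cong₂ _+_ (cong₂ _+_ inside across) outside ⟩
    specht cs vs * (- (+ choose₂ c) * det c us) + + sum cs * (det c us * specht cs vs)
      + det c us * (content cs * specht cs vs)
      ≡⟨ lemma (det c us) (specht cs vs) (content cs) (+ sum cs) (+ choose₂ c) ⟩
    content (c ∷ cs) * (det c us * specht cs vs)
      ≡⟨ cong (content (c ∷ cs) *_) (specht-++ c cs us vs |us|) ⟨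
    content (c ∷ cs) * f (us ++ vs) ∎
    where
    inside : swapAll (λ w → f (w ++ vs)) us ≡ specht cs vs * (- (+ choose₂ c) * det c us)
    inside = begin
      swapAll (λ w → f (w ++ vs)) us
        ≡⟨ swapAll-cong us (λ w |w| → trans (specht-++ c cs w vs (trans |w| |us|))
             (ℤ.*-comm (det c w) (specht cs vs))) ⟩
      swapAll (λ w → specht cs vs * det c w) us
        ≡⟨ swapAll-* (specht cs vs) (det c) us ⟩
      specht cs vs * swapAll (det c) us
        ≡⟨ cong (specht cs vs *_) (swapAll-alternating (det c) (det-alternating c) us) ⟩
      specht cs vs * (- (+ choose₂ (length us)) * det c us)
        ≡⟨ cong (λ l → specht cs vs * (- (+ choose₂ l) * det c us)) |us| ⟩
      specht cs vs * (- (+ choose₂ c) * det c us) ∎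
    across : swapAcross (λ w z → f (w ++ z)) us vs ≡ + sum cs * (det c us * specht cs vs)
    across = begin
      swapAcross (λ w z → f (w ++ z)) us vs
        ≡⟨ swapAcross-cong us vs (λ w z |w| → specht-++ c cs w z (trans |w| |us|)) ⟩
      swapAcross (λ w z → det c w * specht cs z) us vs
        ≡⟨ swapAcross-det c (specht cs) (specht-vanishesAbove c cs dec) us vs ⟩
      + length vs * (det c us * specht cs vs)
        ≡⟨ cong (λ l → + l * (det c us * specht cs vs)) |vs| ⟩
      + sum cs * (det c us * specht cs vs) ∎
    outside : swapAll (λ w → f (us ++ w)) vs ≡ det c us * (content cs * specht cs vs)
    outside = begin
      swapAll (λ w → f (us ++ w)) vs
        ≡⟨ swapAll-cong vs (λ w _ → specht-++ c cs us w |us|) ⟩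
      swapAll (λ w → det c us * specht cs w) vs
        ≡⟨ swapAll-* (det c us) (specht cs) vs ⟩
      det c us * swapAll (specht cs) vs
        ≡⟨ cong (det c us *_) (swapAll-specht c cs dec vs |vs|) ⟩
      det c us * (content cs * specht cs vs) ∎

-- Every cell carries its row index, each column read from bottom to top; a word on which the Specht
-- function is visibly nonzero.
rowWord : List ℕ → Word
rowWord [] = []
rowWord (c ∷ cs) = descending c ++ rowWord cs

length-descending : ∀ m → length (descending m) ≡ m
length-descending zero = refl
length-descending (suc m) = cong suc (length-descending m)

length-rowWord : ∀ cs → length (rowWord cs) ≡ sum cs
length-rowWord [] = refl
length-rowWord (c ∷ cs) =
  trans (length-++ (descending c)) (cong₂ ℕ._+_ (length-descending c) (length-rowWord cs))

specht-rowWord : ∀ cs → specht cs (rowWord cs) ≡ 1ℤ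
specht-rowWord [] = refl
specht-rowWord (c ∷ cs) = trans
  (specht-++ c cs (descending c) (rowWord cs) (length-descending c))
  (cong₂ _*_ (det-descending c) (specht-rowWord cs))

-- Transfer to the transposition graph

Σ[_] : ∀ {n} → (Fin n → ℤ) → ℤ
Σ[ h ] = sumℤ (tabulate h)

Σ-cong : ∀ {n} {g h : Fin n → ℤ} → (∀ i → g i ≡ h i) → Σ[ g ] ≡ Σ[ h ]
Σ-cong g≗h = cong sumℤ (tabulate-cong g≗h)

Σ-zero : ∀ n → Σ[ (λ (_ : Fin n) → 0ℤ) ] ≡ 0ℤ
Σ-zero zero = refl
Σ-zero (suc n) = trans (ℤ.+-identityˡ _) (Σ-zero n)

Σ-+ : ∀ {n} (g h : Fin n → ℤ) → Σ[ (λ i → g i + h i) ] ≡ Σ[ g ] + Σ[ h ]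
Σ-+ {zero} g h = refl
Σ-+ {suc n} g h = trans (cong (_+_ (g zero + h zero)) (Σ-+ (g ∘ suc) (h ∘ suc)))
  (interchange (g zero) (h zero) _ _)

sum-allFin : ∀ {n} (h : Fin n → ℤ) → sumℤ (List.map h (List.allFin n)) ≡ Σ[ h ]
sum-allFin {n} h = cong sumℤ (map-tabulate {n = n} id h)

below : ∀ n → (Fin n → Fin n → ℤ) → Fin n → ℤ
below n F j = Σ[ (λ i → if toℕ i <ᵇ toℕ j then F i j else 0ℤ) ]

sumPairs≡Σ : ∀ n F → sumPairs n F ≡ Σ[ below n F ]
sumPairs≡Σ n F = trans (sum-allFin {n} _) (Σ-cong {n} λ j → sum-allFin {n} _)

sumPairs-suc : ∀ n F → sumPairs (suc n) F ≡
  Σ[ (λ j → F zero (suc j)) ] + sumPairs n (λ i j → F (suc i) (suc j))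
sumPairs-suc n F = begin
  sumPairs (suc n) F
    ≡⟨ sumPairs≡Σ (suc n) F ⟩
  -- The summand for `j = zero` is empty, as no index is smaller; every other one splits off
  -- `i = zero`.
  0ℤ + Σ[ (λ (_ : Fin n) → 0ℤ) ] + Σ[ (λ j → F zero (suc j) + below n F⁺ j) ]
    ≡⟨ cong₂ _+_ (trans (ℤ.+-identityˡ _) (Σ-zero n)) (Σ-+ (λ j → F zero (suc j)) (below n F⁺)) ⟩
  0ℤ + (Σ[ (λ j → F zero (suc j)) ] + Σ[ below n F⁺ ])
    ≡⟨ ℤ.+-identityˡ _ ⟩
  Σ[ (λ j → F zero (suc j)) ] + Σ[ below n F⁺ ]
    ≡⟨ cong (_+_ Σ[ (λ j → F zero (suc j)) ]) (sumPairs≡Σ n F⁺) ⟨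
  Σ[ (λ j → F zero (suc j)) ] + sumPairs n F⁺ ∎
  where
  open ≡-Reasoning
  F⁺ : Fin n → Fin n → ℤ
  F⁺ i j = F (suc i) (suc j)

sumPairs-cong : ∀ n {F G : Fin n → Fin n → ℤ} → (∀ i j → F i j ≡ G i j) →
  sumPairs n F ≡ sumPairs n G
sumPairs-cong n {F} {G} F≗G = trans (sumPairs≡Σ n F) (trans
  (Σ-cong {n} λ j → Σ-cong {n} λ i → cong (if toℕ i <ᵇ toℕ j then_else 0ℤ) (F≗G i j))
  (sym (sumPairs≡Σ n G)))

swapHead-tabulate : ∀ {n} g a (u : Fin n → ℕ) → swapHead g a (tabulate u) ≡
  Σ[ (λ j → g (u j) (tabulate (λ k → if does (k Fin.≟ j) then a else u k))) ]
swapHead-tabulate {zero} g a u = refl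
swapHead-tabulate {suc n} g a u =
  cong (_+_ (g (u zero) (a ∷ tabulate (u ∘ suc))))
    (swapHead-tabulate (λ b w → g b (u zero ∷ w)) a (u ∘ suc))

sumPairs-transp : ∀ {n} f (u : Fin n → ℕ) →
  sumPairs n (λ i j → f (tabulate (u ∘ transp i j))) ≡ swapAll f (tabulate u)
sumPairs-transp {zero} f u = refl
sumPairs-transp {suc n} f u = trans
  (sumPairs-suc n (λ i j → f (tabulate (u ∘ transp i j))))
  (cong₂ _+_
    (trans (Σ-cong {n} λ j → cong (λ w → f (u (suc j) ∷ w)) (tabulate-cong λ k → first (does (k Fin.≟ j)) k))
      (sym (swapHead-tabulate (λ a w → f (a ∷ w)) (u zero) (u ∘ suc))))
    (trans (sumPairs-cong n λ i j → cong (λ w → f (u zero ∷ w))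
        (tabulate-cong λ k → cong u (rest (does (k Fin.≟ i)) (does (k Fin.≟ j)) i j k)))
      (sumPairs-transp (f ∘ (u zero ∷_)) (u ∘ suc))))
  where
  -- Comparing successors in `Fin` has the same Boolean as comparing the indices, so both facts can
  -- be stated for arbitrary Booleans.
  first : ∀ b k → u (if b then zero else suc k) ≡ (if b then u zero else u (suc k))
  first true k = refl
  first false k = refl
  rest : ∀ b c (i j k : Fin n) → (if b then suc j else (if c then suc i else suc k)) ≡
    Fin.suc (if b then j else (if c then i else k))
  rest true c i j k = refl
  rest false true i j k = refl
  rest false false i j k = refl

transp-involutive : ∀ {n} (i j k : Fin n) → transp i j (transp i j k) ≡ k
transp-involutive i j k with k Fin.≟ i
... | yes refl = transp-right
  where
  transp-right : transp k j j ≡ k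
  transp-right with j Fin.≟ k
  ... | yes j≡k = j≡k
  ... | no _ = cong (if_then k else j) (dec-true (j Fin.≟ j) refl)
... | no k≢i with k Fin.≟ j
...   | yes refl = cong (if_then k else (if does (i Fin.≟ k) then i else i)) (dec-true (i Fin.≟ i) refl)
...   | no k≢j = trans (cong (if_then j else (if does (k Fin.≟ j) then i else k)) (dec-false (k Fin.≟ i) k≢i))
  (cong (if_then i else k) (dec-false (k Fin.≟ j) k≢j))

does-transp : ∀ {n} (i j s k : Fin n) → does (transp i j s Fin.≟ k) ≡ does (s Fin.≟ transp i j k)
does-transp i j s k = does-⇔ (mk⇔
  (λ e → trans (sym (transp-involutive i j s)) (cong (transp i j) e))
  (λ e → trans (cong (transp i j) e) (transp-involutive i j k)))
  (transp i j s Fin.≟ k) (s Fin.≟ transp i j k)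

-- For a permutation σ this is w ∘ σ⁻¹.
pullback : ∀ {n m} → Vec (Fin n) m → (Fin m → ℕ) → Fin n → ℕ
pullback [] w k = 0
pullback (s ∷ σ) w k = if does (s Fin.≟ k) then w zero else pullback σ (w ∘ suc) k

-- For an involution t, w ∘ (t ∘ σ)⁻¹ = (w ∘ σ⁻¹) ∘ t: passing to a neighbour in the Cayley graph
-- exchanges two positions of the word.
pullback-transp : ∀ {n m} i j (σ : Vec (Fin n) m) w k →
  pullback (Vec.map (transp i j) σ) w k ≡ pullback σ w (transp i j k)
pullback-transp i j [] w k = refl
pullback-transp i j (s ∷ σ) w k = cong₂ (if_then w zero else_)
  (does-transp i j s k) (pullback-transp i j σ (w ∘ suc) k)

pullback-tabulate : ∀ {n m} (ρ : Fin m → Fin n) → (∀ {i j} → ρ i ≡ ρ j → i ≡ j) →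
  ∀ w i → pullback (Vec.tabulate ρ) w (ρ i) ≡ w i
pullback-tabulate ρ inj w zero =
  cong (if_then w zero else pullback (Vec.tabulate (ρ ∘ suc)) (w ∘ suc) (ρ zero))
    (dec-true (ρ zero Fin.≟ ρ zero) refl)
pullback-tabulate ρ inj w (suc i) = trans
  (cong (if_then w zero else pullback (Vec.tabulate (ρ ∘ suc)) (w ∘ suc) (ρ (suc i)))
    (dec-false (ρ zero Fin.≟ ρ (suc i)) (λ e → contradiction (inj e) λ ())))
  (pullback-tabulate (ρ ∘ suc) (Fin.suc-injective ∘ inj) (w ∘ suc) i)

content-eigenvalue : ∀ h cs → Decreasing h cs →
  IsTranspositionGraphEigenvalue (sum cs) (content cs)
content-eigenvalue h cs dec =
  -- With `n` taken as the length of `rowWord cs`, `lookup` is directly a function on `Fin n`; at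
  -- the identity permutation the eigenvector takes the value of `specht cs` on `rowWord cs`.
  subst (λ n → IsTranspositionGraphEigenvalue n (content cs)) (length-rowWord cs)
    (v , (Vec.allFin n , (λ i → i , lookup-allFin i) , v≢0) , λ σ _ → eigen σ)
  where
  open ≡-Reasoning
  n = length (rowWord cs)
  word : Vec (Fin n) n → Fin n → ℕ
  word σ = pullback σ (lookup (rowWord cs))
  v : Vec (Fin n) n → ℤ
  v σ = specht cs (tabulate (word σ))
  v-id : v (Vec.allFin n) ≡ 1ℤ
  v-id = begin
    specht cs (tabulate (word (Vec.allFin n)))
      ≡⟨ cong (specht cs) (tabulate-cong (pullback-tabulate id id (lookup (rowWord cs)))) ⟩
    specht cs (tabulate (lookup (rowWord cs)))
      ≡⟨ cong (specht cs) (tabulate-lookup (rowWord cs)) ⟩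
    specht cs (rowWord cs)
      ≡⟨ specht-rowWord cs ⟩
    1ℤ ∎
  v≢0 : v (Vec.allFin n) ≢ 0ℤ
  v≢0 v≡0 = contradiction (trans (sym v-id) v≡0) λ ()
  eigen : ∀ σ → adjApply n v σ ≡ content cs * v σ
  eigen σ = begin
    adjApply n v σ
      ≡⟨ sumPairs-cong n (λ i j → cong (specht cs)
           (tabulate-cong (pullback-transp i j σ (lookup (rowWord cs))))) ⟩
    sumPairs n (λ i j → specht cs (tabulate (word σ ∘ transp i j)))
      ≡⟨ sumPairs-transp (specht cs) (word σ) ⟩
    swapAll (specht cs) (tabulate (word σ))
      ≡⟨ swapAll-specht h cs dec _ (trans (length-tabulate (word σ)) (length-rowWord cs)) ⟩
    content cs * v σ ∎

-- Partitions from Frobenius coordinates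

-- The partition with Frobenius coordinates (a ∷ A | b ∷ B) is that of (A | B) wrapped in the hook
-- with arm a and leg b.
addHook : ℕ → ℕ → List ℕ → List ℕ
addHook a b cs = suc b ∷ map suc cs ++ replicate (a ℕ.∸ length cs) 1

Decreasing-ones : ∀ {h} j → 1 ℕ.≤ h → Decreasing h (replicate j 1)
Decreasing-ones zero _ = tt
Decreasing-ones (suc j) 1≤h = 1≤h , Decreasing-ones j ℕ.≤-refl

Decreasing-addHook : ∀ {a b h} cs → b ℕ.< h → Decreasing b cs → Decreasing h (addHook a b cs)
Decreasing-addHook {a} {b} cs b<h dec = b<h , tail cs (a ℕ.∸ length cs) dec
  where
  tail : ∀ {b} cs j → Decreasing b cs → Decreasing (suc b) (map suc cs ++ replicate j 1)
  tail [] j _ = Decreasing-ones j (s≤s z≤n)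
  tail (c ∷ cs) j (c≤b , dec) = s≤s c≤b , tail cs j dec

sum-ones : ∀ j → sum (replicate j 1) ≡ j
sum-ones zero = refl
sum-ones (suc j) = cong suc (sum-ones j)

sum-addRow : ∀ cs j → sum (map suc cs ++ replicate j 1) ≡ sum cs ℕ.+ (length cs ℕ.+ j)
sum-addRow [] j = sum-ones j
sum-addRow (c ∷ cs) j = trans (cong (suc c ℕ.+_) (sum-addRow cs j)) (lemma c (sum cs) (length cs) j)
  where
  lemma : ∀ c s l j → suc c ℕ.+ (s ℕ.+ (l ℕ.+ j)) ≡ c ℕ.+ s ℕ.+ suc (l ℕ.+ j)
  lemma = solveℕ-∀

-- The old cells move down by one row and lose 1 each; the new top row has contents 0, 1, 2, ....
content-addRow : ∀ cs j → content (map suc cs ++ replicate j 1) ≡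
  content cs - + sum cs + + choose₂ (length cs ℕ.+ j)
content-addRow [] zero = refl
content-addRow [] (suc j) = begin
  content (replicate j 1) + + sum (replicate j 1) - 0ℤ
    ≡⟨ cong₂ (λ a b → a + + b - 0ℤ) (content-addRow [] j) (sum-ones j) ⟩
  0ℤ - 0ℤ + + choose₂ j + + j - 0ℤ
    ≡⟨ lemma (+ choose₂ j) (+ j) ⟩
  0ℤ - 0ℤ + (+ j + + choose₂ j) ∎
  where
  open ≡-Reasoning
  lemma : ∀ c j → 0ℤ - 0ℤ + c + j - 0ℤ ≡ 0ℤ - 0ℤ + (j + c)
  lemma = solve-∀
content-addRow (c ∷ cs) j = begin
  content (map suc cs ++ replicate j 1) + + sum (map suc cs ++ replicate j 1) - + choose₂ (suc c)
    ≡⟨ cong₂ (λ a b → a + + b - + choose₂ (suc c)) (content-addRow cs j) (sum-addRow cs j) ⟩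
  content cs - + sum cs + + choose₂ w + (+ sum cs + + w) - (+ c + + choose₂ c)
    ≡⟨ lemma (content cs) (+ sum cs) (+ choose₂ w) (+ w) (+ c) (+ choose₂ c) ⟩
  content cs + + sum cs - + choose₂ c - (+ c + + sum cs) + (+ w + + choose₂ w) ∎
  where
  open ≡-Reasoning
  w = length cs ℕ.+ j
  lemma : ∀ e s t w c d → e - s + t + (s + w) - (c + d) ≡ e + s - d - (c + s) + (w + t)
  lemma = solve-∀

module _ (a b : ℕ) (cs : List ℕ) (w≤a : length cs ℕ.≤ a) where

  private
    rest = map suc cs ++ replicate (a ℕ.∸ length cs) 1
    width : length cs ℕ.+ (a ℕ.∸ length cs) ≡ a
    width = ℕ.m+[n∸m]≡n w≤a
    sum-rest : sum rest ≡ sum cs ℕ.+ a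
    sum-rest = trans (sum-addRow cs _) (cong (sum cs ℕ.+_) width)

  length-addHook : length (addHook a b cs) ≡ suc a
  length-addHook = cong suc (trans (length-++ (map suc cs)) (trans
    (cong₂ ℕ._+_ (length-map suc cs) (length-replicate (a ℕ.∸ length cs))) width))

  sum-addHook : sum (addHook a b cs) ≡ suc (a ℕ.+ b) ℕ.+ sum cs
  sum-addHook = trans (cong (suc b ℕ.+_) sum-rest) (lemma a b (sum cs))
    where
    lemma : ∀ a b s → suc b ℕ.+ (s ℕ.+ a) ≡ suc (a ℕ.+ b) ℕ.+ s
    lemma = solveℕ-∀

  -- The old cells move along the diagonal and keep their contents; the arm adds 1, ..., `a` and the
  -- leg -1, ..., `- b`.
  content-addHook : content (addHook a b cs) ≡ content cs + + triangle a - + triangle b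
  content-addHook = begin
    content rest + + sum rest - + triangle b
      ≡⟨ cong₂ (λ c s → c + + s - + triangle b)
           (trans (content-addRow cs _) (cong (λ w → content cs - + sum cs + + choose₂ w) width))
           sum-rest ⟩
    content cs - + sum cs + + choose₂ a + (+ sum cs + + a) - + triangle b
      ≡⟨ lemma (content cs) (+ sum cs) (+ choose₂ a) (+ a) (+ triangle b) ⟩
    content cs + + triangle a - + triangle b ∎
    where
    open ≡-Reasoning
    lemma : ∀ c s t a b → c - s + t + (s + a) - b ≡ c + (a + t) - b
    lemma = solve-∀

StrictlyDecreasing : ℕ → List ℕ → Set
StrictlyDecreasing h [] = ⊤
StrictlyDecreasing h (a ∷ A) = a ℕ.< h × StrictlyDecreasing a A

-- The induction carries both bounds: column lengths at most `b` make the inner partition fit beside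
-- the new leg, and at most `a` columns make it fit under the new arm.
partition : ∀ {g h} A B → StrictlyDecreasing g A → StrictlyDecreasing h B → length A ≡ length B →
  ∃[ cs ] Decreasing h cs × length cs ℕ.≤ g × sum cs ≡ sum A ℕ.+ sum B ℕ.+ length A ×
    content cs ≡ + sum (map triangle A) - + sum (map triangle B)
partition [] [] _ _ _ = [] , tt , z≤n , refl , refl
partition {g} (a ∷ A) (b ∷ B) (a<g , decA) (b<h , decB) eq
  with cs , dec , w≤a , size , cont ← partition A B decA decB (ℕ.suc-injective eq) =
  addHook a b cs , Decreasing-addHook cs b<h dec ,
  subst (ℕ._≤ g) (sym (length-addHook a b cs w≤a)) a<g ,
  trans (sum-addHook a b cs w≤a)
    (trans (cong (suc (a ℕ.+ b) ℕ.+_) size) (lemma₁ a b (sum A) (sum B) (length A))) ,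
  trans (content-addHook a b cs w≤a)
    (trans (cong (λ c → c + + triangle a - + triangle b) cont)
      (lemma₂ (+ triangle a) (+ triangle b) (+ sum (map triangle A)) (+ sum (map triangle B))))
  where
  lemma₁ : ∀ a b s t l → suc (a ℕ.+ b) ℕ.+ (s ℕ.+ t ℕ.+ l) ≡ a ℕ.+ s ℕ.+ (b ℕ.+ t) ℕ.+ suc l
  lemma₁ = solveℕ-∀
  lemma₂ : ∀ a b s t → s - t + a - b ≡ (a + s) - (b + t)
  lemma₂ = solve-∀

insert : ∀ {h} x xs → x ℕ.< h → All (x ≢_) xs → StrictlyDecreasing h xs →
  ∃[ ys ] StrictlyDecreasing h ys × ys ↭ x ∷ xs
insert x [] x<h _ _ = x ∷ [] , (x<h , tt) , ↭-refl
insert x (y ∷ xs) x<h (x≢y ∷ x∉xs) (y<h , dec) with ℕ.<-cmp x y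
... | tri≈ _ x≡y _ = contradiction x≡y x≢y
... | tri> _ _ y<x = x ∷ y ∷ xs , (x<h , y<x , dec) , ↭-refl
... | tri< x<y _ _ with ys , dec′ , ys↭ ← insert x xs x<y x∉xs dec =
  y ∷ ys , (y<h , dec′) , ↭-trans (prep y ys↭) (swap y x ↭-refl)

StrictlyDecreasing-mono : ∀ {g h} A → g ℕ.≤ h → StrictlyDecreasing g A → StrictlyDecreasing h A
StrictlyDecreasing-mono [] _ _ = tt
StrictlyDecreasing-mono (a ∷ A) g≤h (a<g , dec) = ℕ.≤-trans a<g g≤h , dec

-- `partition` needs strictly decreasing coordinates, while `Coordinates` gives sets in any order;
-- size and content are sums, so reordering preserves them.
sort : ∀ xs → Unique xs → ∃₂ λ h ys → StrictlyDecreasing h ys × ys ↭ xs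
sort [] _ = 0 , [] , tt , ↭-refl
sort (x ∷ xs) (x∉xs ∷ uniq)
  with h , ys , dec , ys↭ ← sort xs uniq
  with zs , dec′ , zs↭ ← insert x ys (ℕ.m≤m⊔n (suc x) h) (All-resp-↭ (↭-sym ys↭) x∉xs)
    (StrictlyDecreasing-mono ys (ℕ.m≤n⊔m (suc x) h) dec) =
  suc x ℕ.⊔ h , zs , dec′ , ↭-trans zs↭ (prep x ys↭)

frobenius-eigenvalue : ∀ A B → Unique A → Unique B → length A ≡ length B →
  IsTranspositionGraphEigenvalue (sum A ℕ.+ sum B ℕ.+ length A)
    (+ sum (map triangle A) - + sum (map triangle B))
frobenius-eigenvalue A B uniqA uniqB eq
  with g , A′ , decA , A↭ ← sort A uniqA
  with h , B′ , decB , B↭ ← sort B uniqB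
  with cs , dec , _ , size , cont ← partition A′ B′ decA decB
    (trans (↭-length A↭) (trans eq (sym (↭-length B↭)))) =
  subst₂ IsTranspositionGraphEigenvalue
    (trans size (cong₂ ℕ._+_ (cong₂ ℕ._+_ (sum-↭ A↭) (sum-↭ B↭)) (↭-length A↭)))
    (trans cont (cong₂ (λ s t → + s - + t) (sum-↭ (map⁺ triangle A↭)) (sum-↭ (map⁺ triangle B↭))))
    (content-eigenvalue h cs dec)

eigenvalue⁺ : ∀ {n k} → Coordinates n k → IsTranspositionGraphEigenvalue n (+ k)
eigenvalue⁺ {k = k} (A , B , uniqA , uniqB , eq , size , T) =
  subst₂ IsTranspositionGraphEigenvalue size
    (trans (cong (λ t → + t - + sum (map triangle B)) T) (lemma (+ k) (+ sum (map triangle B))))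
    (frobenius-eigenvalue A B uniqA uniqB eq)
  where
  lemma : ∀ k t → k + t - t ≡ k
  lemma = solve-∀

-- Conjugation of the partition exchanges arms and legs, which keeps the size and negates the
-- content.
eigenvalue⁻ : ∀ {n k} → Coordinates n k → IsTranspositionGraphEigenvalue n (- + k)
eigenvalue⁻ {k = k} (A , B , uniqA , uniqB , eq , size , T) =
  subst₂ IsTranspositionGraphEigenvalue
    (trans (cong₂ ℕ._+_ (ℕ.+-comm (sum B) (sum A)) (sym eq)) size)
    (trans (cong (λ t → + sum (map triangle B) - + t) T) (lemma (+ k) (+ sum (map triangle B))))
    (frobenius-eigenvalue B A uniqB uniqA (sym eq))
  where
  lemma : ∀ k t → t - (k + t) ≡ - k
  lemma = solve-∀

theorem3p3 : (n : ℕ) → n ≥ 15 → (k : ℤ) →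
    - (+ (((n ∸ 15) / 3) C 2)) ≤ k → k ≤ + (((n ∸ 15) / 3) C 2) →
    IsTranspositionGraphEigenvalue n k
theorem3p3 n n≥15 k lower upper = cases k lower upper
  where
  q = (n ∸ 15) / 3
  large : 15 ℕ.+ 3 ℕ.* q ℕ.≤ n
  large = begin
    15 ℕ.+ 3 ℕ.* q   ≡⟨ cong (ℕ._+_ 15) (ℕ.*-comm 3 q) ⟩
    15 ℕ.+ q ℕ.* 3   ≤⟨ ℕ.+-monoʳ-≤ 15 (m/n*n≤m (n ∸ 15) 3) ⟩
    15 ℕ.+ (n ∸ 15)  ≡⟨ ℕ.m+[n∸m]≡n n≥15 ⟩
    n                ∎
    where open ℕ.≤-Reasoning
  coords : ∀ k → k ℕ.≤ q C 2 → Coordinates n k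
  coords k k≤ = coordinates n q k large (subst (k ℕ.≤_) (sym (choose₂≡C q)) k≤)
  cases : ∀ k → - + (q C 2) ≤ k → k ≤ + (q C 2) → IsTranspositionGraphEigenvalue n k
  cases (+ k) _ upper = eigenvalue⁺ (coords k (ℤ.drop‿+≤+ upper))
  cases -[1+ k ] lower _ = eigenvalue⁻ (coords (suc k) (ℤ.drop‿+≤+ (ℤ.neg-cancel-≤ lower)))
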